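{- Let $q_1,q_2,q_3\ge 0$ with $q_1+q_2+q_3=1$, and let $(\mathcal{G}_3',u)$ be the initializing extension of $(\mathcal{G}_3,u)$ with initial distribution $(q_1,q_2,q_3)$, considered under the Markov realization, where the payoff $u$ satisfies $$u_1(a_2)>u_1(a_1)>u_1(a_3)>u_1(c),\quad u_2(a_3)>u_2(a_2)>u_2(a_1)>u_2(c),\quad u_3(a_1)>u_3(a_3)>u_3(a_2)>u_3(c).$$ Set $$\mu_1=\frac{u_1(a_2)-u_1(a_1)}{u_1(a_1)-u_1(a_3)},\quad \mu_2=\frac{u_2(a_3)-u_2(a_2)}{u_2(a_2)-u_2(a_1)},\quad \mu_3=\frac{u_3(a_1)-u_3(a_3)}{u_3(a_3)-u_3(a_2)}.$$ If $\mu_1\mu_2\mu_3<1$, then $(\mathcal{G}_3',u)$ has a unique Nash equilibrium in strictly mixed strategies, and it is given by $$p_1=\frac{\mu_3(1+\mu_1+\mu_1\mu_2)}{1+\mu_3+\mu_3\mu_1},\quad p_2=\frac{\mu_1(1+\mu_2+\mu_2\mu_3)}{1+\mu_1+\mu_1\mu_2},\quad p_3=\frac{\mu_2(1+\mu_3+\mu_3\mu_1)}{1+\mu_2+\mu_2\mu_3}.$$ If $\mu_1\mu_2\mu_3\ge 1$, then $(\mathcal{G}_3',u)$ has no Nash equilibrium in strictly mixed strategies.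
   Context: Game structure $\mathcal{G}_3$: the directed graph has non-terminal positions $v_1,v_2,v_3$, terminal positions $a_1,a_2,a_3$, and arcs $(v_1,v_2),(v_2,v_3),(v_3,v_1)$ (the cycle) and $(v_i,a_i)$, $i=1,2,3$. Player $i\in\{1,2,3\}$ controls $v_i$. The outcomes are $a_1,a_2,a_3$ (termination there) and $c$ (infinite play). A payoff is $u:\{1,2,3\}\times\{a_1,a_2,a_3,c\}\to\mathbb{R}$, written $u_i(a)$. The initializing extension $\mathcal{G}_3'$ adds a position of chance $v_0$, which is the initial position, with moves $(v_0,v_j)$ taken with probability $q_j$, $j=1,2,3$. A mixed strategy of player $i$ is a number $p_i\in[0,1]$: the probability of following the cycle from $v_i$; with probability $1-p_i$ the player moves to $a_i$. Under the Markov realization the move is drawn afresh and independently each time a position is visited. Thus if $p_1=p_2=p_3=1$ the outcome is $c$ with probability 1; otherwise, with $\Delta=1-p_1p_2p_3$, the distribution on $(a_1,a_2,a_3,c)$ is $\frac1\Delta(1-p_1,\;p_1(1-p_2),\;p_1p_2(1-p_3),\;0)$ when play starts in $v_1$, $\frac1\Delta(p_2p_3(1-p_1),\;1-p_2,\;p_2(1-p_3),\;0)$ when it starts in $v_2$, $\frac1\Delta(p_3(1-p_1),\;p_1p_3(1-p_2),\;1-p_3,\;0)$ when it starts in $v_3$. In $\mathcal{G}_3'$ the expected payoff of player $i$ is $\sum_{j=1}^3 q_j$ times the expectation of $u_i$ when starting in $v_j$. A triple $(p_1,p_2,p_3)\in[0,1]^3$ is a Nash equilibrium of $(\mathcal{G}_3',u)$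 if no player can strictly increase his expected payoff by changing only his own $p_i$ to any other value in $[0,1]$. It is in strictly mixed strategies if $0<p_i<1$ for $i=1,2,3$. -}

module Defs where

open import Algebra.Bundles using (CommutativeRing)
open import Algebra.Core using (Op₁; Op₂)
open import Algebra.Structures using (IsCommutativeRing)
open import Data.Bool.Base using (if_then_else_)
open import Data.Fin.Base using (Fin; zero; suc)
open import Data.Fin.Properties using (all?)
open import Data.Product.Base using (_×_; ∃)
open import Data.Sum.Base using (_⊎_)
open import Data.Vec.Functional using (Vector; updateAt)
open import Function.Base using (const)
open import Level using (_⊔_) renaming (suc to lsuc)
open import Relation.Binary.Core using (Rel)
open import Relation.Binary.Structures using (IsStrictTotalOrder)
open import Relation.Nullary using (¬_; does)
open import Relation.Unary using (Pred)

-- The order is trichotomous, so equality and order are decidable, as in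
-- classical mathematics.
record OrderedField c ℓ₁ ℓ₂ : Set (lsuc (c ⊔ ℓ₁ ⊔ ℓ₂)) where
  infix  8 -_
  infix  9 _⁻¹
  infixl 7 _*_ _/_
  infixl 6 _+_
  infix  4 _≈_ _<_ _≤_ _>_ _≥_
  field
    Carrier : Set c
    _≈_     : Rel Carrier ℓ₁
    _<_     : Rel Carrier ℓ₂
    _+_     : Op₂ Carrier
    _*_     : Op₂ Carrier
    -_      : Op₁ Carrier
    _⁻¹     : Op₁ Carrier
    0#      : Carrier
    1#      : Carrier

    isCommutativeRing  : IsCommutativeRing _≈_ _+_ _*_ -_ 0# 1#
    isStrictTotalOrder : IsStrictTotalOrder _≈_ _<_

    -- The inverse is a total operation; nothing is assumed of the value 0# ⁻¹.
    ⁻¹-cong   : ∀ {x y} → x ≈ y → x ⁻¹ ≈ y ⁻¹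
    *-inverse : ∀ x → ¬ (x ≈ 0#) → x * x ⁻¹ ≈ 1#
    1≉0       : ¬ (1# ≈ 0#)

    +-monoˡ-< : ∀ z {x y} → x < y → x + z < y + z
    *-pos     : ∀ {x y} → 0# < x → 0# < y → 0# < x * y

  commutativeRing : CommutativeRing c ℓ₁
  commutativeRing = record { isCommutativeRing = isCommutativeRing }

  open CommutativeRing commutativeRing public using (_-_; setoid)
  open IsStrictTotalOrder isStrictTotalOrder public using (compare; _≟_; _<?_)

  _/_ : Op₂ Carrier
  x / y = x * y ⁻¹

  _≤_ : Rel Carrier (ℓ₁ ⊔ ℓ₂)
  x ≤ y = x < y ⊎ x ≈ y

  _>_ : Rel Carrier ℓ₂
  x > y = y < x

  _≥_ : Rel Carrier (ℓ₁ ⊔ ℓ₂)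
  x ≥ y = y ≤ x

module _ {c ℓ₁ ℓ₂} (F : OrderedField c ℓ₁ ℓ₂) where
  open OrderedField F

  UpperBound : ∀ {s} → Pred Carrier s → Carrier → Set (c ⊔ ℓ₁ ⊔ ℓ₂ ⊔ s)
  UpperBound S b = ∀ x → S x → x ≤ b

  LeastUpperBound : ∀ {s} → Pred Carrier s → Carrier → Set (c ⊔ ℓ₁ ⊔ ℓ₂ ⊔ s)
  LeastUpperBound S b = UpperBound S b × (∀ b′ → UpperBound S b′ → b ≤ b′)

-- The real numbers, characterised (up to unique isomorphism) as a
-- Dedekind-complete ordered field.
record RealField c ℓ₁ ℓ₂ : Set (lsuc (c ⊔ ℓ₁ ⊔ ℓ₂)) where
  field
    orderedField : OrderedField c ℓ₁ ℓ₂

  open OrderedField orderedField public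

  field
    complete : (S : Pred Carrier (c ⊔ ℓ₁ ⊔ ℓ₂)) → ∃ S →
               ∃ (UpperBound orderedField S) →
               ∃ (LeastUpperBound orderedField S)

pattern 𝟏 = zero
pattern 𝟐 = suc zero
pattern 𝟑 = suc (suc zero)

Player : Set
Player = Fin 3

data Outcome : Set where
  a : Player → Outcome   -- termination at aᵢ
  c : Outcome            -- infinite play

module Game {r ℓ₁ ℓ₂} (ℝ : RealField r ℓ₁ ℓ₂) where
  open RealField ℝ

  Payoff : Set r
  Payoff = Player → Outcome → Carrier

  -- p i is the probability of following the cycle from vᵢ.
  Profile : Set r
  Profile = Vector Carrier 3

  -- q j is the probability that chance moves from v₀ to vⱼ.
  InitialDistribution : Vector Carrier 3 → Set (ℓ₁ ⊔ ℓ₂)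
  InitialDistribution q = (∀ j → q j ≥ 0#) × (q 𝟏 + q 𝟐 + q 𝟑 ≈ 1#)

  InUnitInterval : Carrier → Set (ℓ₁ ⊔ ℓ₂)
  InUnitInterval x = 0# ≤ x × x ≤ 1#

  Δ : Profile → Carrier
  Δ p = 1# - p 𝟏 * p 𝟐 * p 𝟑

  infiniteDistribution : Outcome → Carrier
  infiniteDistribution (a _) = 0#
  infiniteDistribution c     = 1#

  -- Markov realization, play starting in vⱼ, some player leaving the cycle
  -- with positive probability: the first factor of the numerator for aᵢ is the
  -- probability of following the cycle from vⱼ up to the first visit to vᵢ.
  terminatingDistribution : Profile → Fin 3 → Outcome → Carrier
  terminatingDistribution p 𝟏 (a 𝟏) = (1# - p 𝟏) / Δ p
  terminatingDistribution p 𝟏 (a 𝟐) = (p 𝟏 * (1# - p 𝟐)) / Δ p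
  terminatingDistribution p 𝟏 (a 𝟑) = (p 𝟏 * p 𝟐 * (1# - p 𝟑)) / Δ p
  terminatingDistribution p 𝟐 (a 𝟏) = (p 𝟐 * p 𝟑 * (1# - p 𝟏)) / Δ p
  terminatingDistribution p 𝟐 (a 𝟐) = (1# - p 𝟐) / Δ p
  terminatingDistribution p 𝟐 (a 𝟑) = (p 𝟐 * (1# - p 𝟑)) / Δ p
  terminatingDistribution p 𝟑 (a 𝟏) = (p 𝟑 * (1# - p 𝟏)) / Δ p
  terminatingDistribution p 𝟑 (a 𝟐) = (p 𝟏 * p 𝟑 * (1# - p 𝟐)) / Δ p
  terminatingDistribution p 𝟑 (a 𝟑) = (1# - p 𝟑) / Δ p
  terminatingDistribution p _ c     = 0#

  outcomeDistribution : Profile → Fin 3 → Outcome → Carrier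
  outcomeDistribution p j =
    if does (all? (λ i → p i ≟ 1#))
    then infiniteDistribution
    else terminatingDistribution p j

  expectation : (Outcome → Carrier) → (Outcome → Carrier) → Carrier
  expectation d f = d (a 𝟏) * f (a 𝟏) + d (a 𝟐) * f (a 𝟐) + d (a 𝟑) * f (a 𝟑) + d c * f c

  expectedPayoff : Vector Carrier 3 → Payoff → Profile → Player → Carrier
  expectedPayoff q u p i = q 𝟏 * E 𝟏 + q 𝟐 * E 𝟐 + q 𝟑 * E 𝟑
    where
    E : Fin 3 → Carrier
    E j = expectation (outcomeDistribution p j) (u i)

  deviate : Profile → Player → Carrier → Profile
  deviate p i x = updateAt p i (const x)

  NashEquilibrium : Vector Carrier 3 → Payoff → Profile → Set (r ⊔ ℓ₁ ⊔ ℓ₂)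
  NashEquilibrium q u p =
    (∀ i → InUnitInterval (p i)) ×
    (∀ i x → InUnitInterval x →
      ¬ (expectedPayoff q u (deviate p i x) i > expectedPayoff q u p i))

  StrictlyMixed : Profile → Set ℓ₂
  StrictlyMixed p = ∀ i → 0# < p i × p i < 1#

  StrictlyMixedEquilibrium : Vector Carrier 3 → Payoff → Profile → Set (r ⊔ ℓ₁ ⊔ ℓ₂)
  StrictlyMixedEquilibrium q u p = NashEquilibrium q u p × StrictlyMixed p

{-# OPTIONS --safe #-}
module Submission where

-- Let y and z be the probabilities with which the two players after player i
-- follow the cycle.  As a function of his own probability x, the payoff of
-- player i is C + K D x / (1 − x y z), where C, K and D do not depend on x,
-- where K > 0 when y and z lie strictly between 0 and 1, and where
-- D = (1 − y) (uᵢ(aⱼ) − uᵢ(aᵢ)) − y (1 − z) (uᵢ(aᵢ) − uᵢ(aₖ)).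
-- Since x / (1 − x y z) increases strictly, an interior x is optimal exactly
-- when D = 0, that is, when μᵢ (1 − y) = y (1 − z).  Multiplying these three
-- equations gives μ₁ μ₂ μ₃ = p₁ p₂ p₃ < 1; with this relation the system
-- becomes triangular: (1 − y) (1 + μᵢ + μᵢ μⱼ) = 1 − μ₁ μ₂ μ₃.

open import Defs
open import Algebra.Bundles using (CommutativeRing)
import Algebra.Properties.Ring
import Algebra.Properties.Semiring.Mult.TCOptimised
import Algebra.Solver.Ring
open import Algebra.Solver.Ring.AlmostCommutativeRing
  using (fromCommutativeRing; _-Raw-AlmostCommutative⟶_)
open import Data.Fin.Properties using (all?)
open import Data.Integer.Base as ℤ using (ℤ; +_; -[1+_]; +[1+_]; _⊖_)
import Data.Integer.Properties as ℤ
open import Data.Maybe.Base using (Maybe; just; nothing)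
open import Data.Nat.Base as ℕ using (zero; suc)
import Data.Nat.Properties as ℕ
open import Data.Product using (_×_; _,_; ∃; proj₁; proj₂)
open import Data.Sum.Base using (inj₁; inj₂)
open import Data.Vec.Functional using (Vector; _∷_; [])
open import Relation.Binary.Definitions using (tri<; tri≈; tri>)
open import Relation.Binary.PropositionalEquality as ≡ using (_≡_)
import Relation.Binary.Reasoning.Setoid
open import Relation.Binary.Structures using (IsStrictTotalOrder)
open import Relation.Nullary using (¬_; yes; no)
open import Relation.Nullary.Decidable using (dec-false)
open import Relation.Nullary.Negation using (contradiction)

-- Ring normalisation with integer coefficients

module IntegerRingSolver {r ℓ} (R : CommutativeRing r ℓ) where
  open CommutativeRing R hiding (zero)
  open Algebra.Properties.Ring ring
  open Algebra.Properties.Semiring.Mult.TCOptimised semiring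
    renaming (_×_ to _·_)
  open Relation.Binary.Reasoning.Setoid setoid

  -- The canonical homomorphism from the integers. Coefficients taken there compute and have
  -- decidable equality, so the solver can recognise cancelling terms.
  fromℤ : ℤ → Carrier
  fromℤ (+ n)    = n · 1#
  fromℤ -[1+ n ] = - (suc n · 1#)

  fromℤ-neg : ∀ i → fromℤ (ℤ.- i) ≈ - fromℤ i
  fromℤ-neg (+ zero)  = sym -0#≈0#
  fromℤ-neg +[1+ n ]  = refl
  fromℤ-neg -[1+ n ]  = sym (-‿involutive _)

  fromℤ-⊖ : ∀ m n → fromℤ (m ⊖ n) ≈ m · 1# - n · 1#
  fromℤ-⊖ m       zero    = begin
    m · 1#         ≈⟨ +-identityʳ _ ⟨
    m · 1# + 0#    ≈⟨ +-congˡ -0#≈0# ⟨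
    m · 1# - 0#    ∎
  fromℤ-⊖ zero    (suc n) = sym (+-identityˡ _)
  fromℤ-⊖ (suc m) (suc n) = begin
    fromℤ (suc m ⊖ suc n)              ≡⟨ ≡.cong fromℤ (ℤ.[1+m]⊖[1+n]≡m⊖n m n) ⟩
    fromℤ (m ⊖ n)                      ≈⟨ fromℤ-⊖ m n ⟩
    m · 1# - n · 1#                    ≈⟨ +-congʳ (+-identityʳ _) ⟨
    -- A cancelling pair `1# - 1#` is inserted, so that each side of the difference can absorb one
    -- unit.
    m · 1# + 0# - n · 1#               ≈⟨ +-congʳ (+-congˡ (-‿inverseʳ 1#)) ⟨
    m · 1# + (1# - 1#) - n · 1#        ≈⟨ +-congʳ (+-assoc _ _ _) ⟨
    m · 1# + 1# - 1# - n · 1#          ≈⟨ +-assoc _ _ _ ⟩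
    m · 1# + 1# + (- 1# - n · 1#)      ≈⟨ +-cong (+-comm _ _) (-‿+-comm _ _) ⟩
    1# + m · 1# - (1# + n · 1#)        ≈⟨ +-cong (1+× m 1#) (-‿cong (1+× n 1#)) ⟨
    suc m · 1# - suc n · 1#            ∎

  fromℤ-+ : ∀ i j → fromℤ (i ℤ.+ j) ≈ fromℤ i + fromℤ j
  fromℤ-+ (+ m)    (+ n)    = ×-homo-+ 1# m n
  fromℤ-+ (+ m)    -[1+ n ] = fromℤ-⊖ m (suc n)
  fromℤ-+ -[1+ m ] (+ n)    = trans (fromℤ-⊖ n (suc m)) (+-comm _ _)
  fromℤ-+ -[1+ m ] -[1+ n ] = begin
    - (suc (suc (m ℕ.+ n)) · 1#)   ≡⟨ ≡.cong (λ k → - (k · 1#)) (ℕ.+-suc (suc m) n) ⟨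
    - ((suc m ℕ.+ suc n) · 1#)     ≈⟨ -‿cong (×-homo-+ 1# (suc m) (suc n)) ⟩
    - (suc m · 1# + suc n · 1#)    ≈⟨ -‿+-comm _ _ ⟨
    - (suc m · 1#) - suc n · 1#    ∎

  -- A negative right factor is reduced to a positive one by pulling out the sign; `fromℤ-*` then
  -- does the same on the left.
  fromℤ-pos-* : ∀ m j → fromℤ (+ m ℤ.* j) ≈ fromℤ (+ m) * fromℤ j
  fromℤ-pos-* m (+ n)    = begin
    fromℤ (+ m ℤ.* + n)                ≡⟨ ≡.cong fromℤ (ℤ.pos-* m n) ⟨
    (m ℕ.* n) · 1#                     ≈⟨ ×1-homo-* m n ⟩
    (m · 1#) * (n · 1#)                ∎
  fromℤ-pos-* m -[1+ n ] = begin
    fromℤ (+ m ℤ.* -[1+ n ])           ≡⟨ ≡.cong fromℤ (ℤ.neg-distribʳ-* (+ m) +[1+ n ]) ⟨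
    fromℤ (ℤ.- (+ m ℤ.* +[1+ n ]))     ≈⟨ fromℤ-neg (+ m ℤ.* +[1+ n ]) ⟩
    - fromℤ (+ m ℤ.* +[1+ n ])         ≈⟨ -‿cong (fromℤ-pos-* m (+ suc n)) ⟩
    - ((m · 1#) * (suc n · 1#))        ≈⟨ -‿distribʳ-* _ _ ⟩
    (m · 1#) * - (suc n · 1#)          ∎

  fromℤ-* : ∀ i j → fromℤ (i ℤ.* j) ≈ fromℤ i * fromℤ j
  fromℤ-* (+ m)    j = fromℤ-pos-* m j
  fromℤ-* -[1+ m ] j = begin
    fromℤ (-[1+ m ] ℤ.* j)             ≡⟨ ≡.cong fromℤ (ℤ.neg-distribˡ-* +[1+ m ] j) ⟨
    fromℤ (ℤ.- (+[1+ m ] ℤ.* j))       ≈⟨ fromℤ-neg (+[1+ m ] ℤ.* j) ⟩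
    - fromℤ (+[1+ m ] ℤ.* j)           ≈⟨ -‿cong (fromℤ-pos-* (suc m) j) ⟩
    - ((suc m · 1#) * fromℤ j)         ≈⟨ -‿distribˡ-* _ _ ⟩
    - (suc m · 1#) * fromℤ j           ∎

  morphism : ℤ.+-*-rawRing -Raw-AlmostCommutative⟶ fromCommutativeRing R
  morphism = record
    { ⟦_⟧    = fromℤ
    ; +-homo = fromℤ-+
    ; *-homo = fromℤ-*
    ; -‿homo = fromℤ-neg
    ; 0-homo = refl
    ; 1-homo = refl
    }

  fromℤ-≟ : ∀ i j → Maybe (fromℤ i ≈ fromℤ j)
  fromℤ-≟ i j with i ℤ.≟ j
  ... | yes i≡j = just (reflexive (≡.cong fromℤ i≡j))
  ... | no  _   = nothing

  open Algebra.Solver.Ring ℤ.+-*-rawRing (fromCommutativeRing R) morphism fromℤ-≟ public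
    using (Polynomial; solve; con; _:+_; _:*_; _:-_; _:=_)

  :0 :1 : ∀ {n} → Polynomial n
  :0 = con (+ 0)
  :1 = con (+ 1)

-- Arithmetic of ordered fields

module OrderedFieldProperties {r ℓ₁ ℓ₂} (F : OrderedField r ℓ₁ ℓ₂) where
  open OrderedField F
  open CommutativeRing commutativeRing public
    using ( refl; sym; trans
          ; +-cong; +-congˡ; +-congʳ; +-comm; +-identityˡ; +-identityʳ
          ; *-cong; *-congˡ; *-congʳ; *-assoc; *-identityʳ
          ; zeroˡ; zeroʳ; -‿cong; -‿inverseʳ )
  open IsStrictTotalOrder isStrictTotalOrder public
    using (<-respˡ-≈; <-respʳ-≈) renaming (irrefl to <-irrefl; trans to <-trans)
  open IntegerRingSolver commutativeRing public
  open Relation.Binary.Reasoning.Setoid setoid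

  x<y⇒0<y-x : ∀ {x y} → x < y → 0# < y - x
  x<y⇒0<y-x {x} x<y = <-respˡ-≈ (-‿inverseʳ x) (+-monoˡ-< (- x) x<y)

  0<y-x⇒x<y : ∀ {x y} → 0# < y - x → x < y
  0<y-x⇒x<y {x} {y} 0<y-x =
    <-respˡ-≈ (+-identityˡ x)
      (<-respʳ-≈ (solve 2 (λ x y → y :- x :+ x := y) refl x y) (+-monoˡ-< x 0<y-x))

  x-y≈0⇒x≈y : ∀ {x y} → x - y ≈ 0# → x ≈ y
  x-y≈0⇒x≈y {x} {y} x-y≈0 = begin
    x          ≈⟨ solve 2 (λ x y → x := x :- y :+ y) refl x y ⟩
    x - y + y  ≈⟨ +-congʳ x-y≈0 ⟩
    0# + y     ≈⟨ +-identityˡ y ⟩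
    y          ∎

  x≈y⇒x-y≈0 : ∀ {x y} → x ≈ y → x - y ≈ 0#
  x≈y⇒x-y≈0 {x} {y} x≈y = trans (+-congʳ x≈y) (-‿inverseʳ y)

  +-monoʳ-< : ∀ z {x y} → x < y → z + x < z + y
  +-monoʳ-< z {x} {y} x<y = <-respˡ-≈ (+-comm x z) (<-respʳ-≈ (+-comm y z) (+-monoˡ-< z x<y))

  +-pos-nonneg : ∀ {x y} → 0# < x → 0# ≤ y → 0# < x + y
  +-pos-nonneg {x} 0<x (inj₁ 0<y) =
    <-trans 0<x (<-respˡ-≈ (+-identityʳ x) (+-monoʳ-< x 0<y))
  +-pos-nonneg {x} 0<x (inj₂ 0≈y) =
    <-respʳ-≈ (trans (sym (+-identityʳ x)) (+-congˡ 0≈y)) 0<x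

  +-pos : ∀ {x y} → 0# < x → 0# < y → 0# < x + y
  +-pos 0<x 0<y = +-pos-nonneg 0<x (inj₁ 0<y)

  +-nonneg : ∀ {x y} → 0# ≤ x → 0# ≤ y → 0# ≤ x + y
  +-nonneg         (inj₁ 0<x) 0≤y = inj₁ (+-pos-nonneg 0<x 0≤y)
  +-nonneg {x} {y} (inj₂ 0≈x) (inj₁ 0<y) =
    inj₁ (<-respʳ-≈ (trans (sym (+-identityˡ y)) (+-congʳ 0≈x)) 0<y)
  +-nonneg         (inj₂ 0≈x) (inj₂ 0≈y) =
    inj₂ (trans (sym (+-identityˡ 0#)) (+-cong 0≈x 0≈y))

  *-nonneg-pos : ∀ {x y} → 0# ≤ x → 0# < y → 0# ≤ x * y
  *-nonneg-pos         (inj₁ 0<x) 0<y = inj₁ (*-pos 0<x 0<y)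
  *-nonneg-pos {y = y} (inj₂ 0≈x) _   = inj₂ (trans (sym (zeroˡ y)) (*-congʳ 0≈x))

  *-monoˡ-<-pos : ∀ {k x y} → 0# < k → x < y → k * x < k * y
  *-monoˡ-<-pos {k} {x} {y} 0<k x<y = 0<y-x⇒x<y
    (<-respʳ-≈ (solve 3 (λ k x y → k :* (y :- x) := k :* y :- k :* x) refl k x y)
      (*-pos 0<k (x<y⇒0<y-x x<y)))

  *-monoˡ-<-neg : ∀ {k x y} → k < 0# → x < y → k * y < k * x
  *-monoˡ-<-neg {k} {x} {y} k<0 x<y = 0<y-x⇒x<y
    (<-respʳ-≈ (solve 3 (λ k x y → (:0 :- k) :* (y :- x) := k :* x :- k :* y) refl k x y)
      (*-pos (x<y⇒0<y-x k<0) (x<y⇒0<y-x x<y)))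

  *-cancelʳ : ∀ {x y z} → ¬ z ≈ 0# → x * z ≈ y * z → x ≈ y
  *-cancelʳ {x} {y} {z} z≉0 xz≈yz = begin
    x               ≈⟨ expand x ⟩
    x * z * z ⁻¹    ≈⟨ *-congʳ xz≈yz ⟩
    y * z * z ⁻¹    ≈⟨ expand y ⟨
    y               ∎
    where
    expand : ∀ t → t ≈ t * z * z ⁻¹
    expand t = begin
      t               ≈⟨ *-identityʳ t ⟨
      t * 1#          ≈⟨ *-congˡ (*-inverse z z≉0) ⟨
      t * (z * z ⁻¹)  ≈⟨ *-assoc t z (z ⁻¹) ⟨
      t * z * z ⁻¹    ∎

  pos⇒≉0 : ∀ {x} → 0# < x → ¬ x ≈ 0#
  pos⇒≉0 0<x x≈0 = <-irrefl (sym x≈0) 0<x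

  0<1 : 0# < 1#
  0<1 with compare 0# 1#
  ... | tri< 0<1 _ _ = 0<1
  ... | tri≈ _ 0≈1 _ = contradiction (sym 0≈1) 1≉0
  -- If 1 were negative, its negative would be positive, and the square of that is 1 again.
  ... | tri> _ _ 1<0 =
    <-respʳ-≈ (solve 0 ((:0 :- :1) :* (:0 :- :1) := :1) refl)
      (*-pos (x<y⇒0<y-x 1<0) (x<y⇒0<y-x 1<0))

  -- Otherwise the product of `x` and its inverse, which is 1, would be zero or negative.
  ⁻¹-pos : ∀ {x} → 0# < x → 0# < x ⁻¹
  ⁻¹-pos {x} 0<x with compare 0# (x ⁻¹)
  ... | tri< 0<x⁻¹ _ _ = 0<x⁻¹
  ... | tri≈ _ 0≈x⁻¹ _ = contradiction
    (trans (sym (*-inverse x (pos⇒≉0 0<x))) (trans (*-congˡ (sym 0≈x⁻¹)) (zeroʳ x))) 1≉0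
  ... | tri> _ _ x⁻¹<0 = contradiction
    (<-trans 0<1 (<-respˡ-≈ (*-inverse x (pos⇒≉0 0<x))
      (<-respʳ-≈ (zeroʳ x) (*-monoˡ-<-pos 0<x x⁻¹<0))))
    (<-irrefl refl)

  /-pos : ∀ {x y} → 0# < x → 0# < y → 0# < x / y
  /-pos 0<x 0<y = *-pos 0<x (⁻¹-pos 0<y)

  /-unique : ∀ {x y z} → ¬ y ≈ 0# → z * y ≈ x → z ≈ x / y
  /-unique {x} {y} {z} y≉0 zy≈x = begin
    z              ≈⟨ *-identityʳ z ⟨
    z * 1#         ≈⟨ *-congˡ (*-inverse y y≉0) ⟨
    z * (y * y ⁻¹) ≈⟨ *-assoc z y (y ⁻¹) ⟨
    z * y * y ⁻¹   ≈⟨ *-congʳ zy≈x ⟩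
    x * y ⁻¹       ∎

  /-*-cancel : ∀ {x y} → ¬ y ≈ 0# → x / y * y ≈ x
  /-*-cancel {x} {y} y≉0 = begin
    x * y ⁻¹ * y    ≈⟨ solve 3 (λ x y w → x :* w :* y := x :* (y :* w)) refl x y (y ⁻¹) ⟩
    x * (y * y ⁻¹)  ≈⟨ *-congˡ (*-inverse y y≉0) ⟩
    x * 1#          ≈⟨ *-identityʳ x ⟩
    x               ∎

  -- The cross-multiplied inequality is scaled by the positive factor `y ⁻¹ * w ⁻¹`.
  /-mono-< : ∀ {x y z w} → 0# < y → 0# < w → x * w < z * y → x / y < z / w
  /-mono-< {x} {y} {z} {w} 0<y 0<w xw<zy =
    <-respˡ-≈ (begin
      y ⁻¹ * w ⁻¹ * (x * w)  ≈⟨ solve 4 (λ x y′ w w′ →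
                                  y′ :* w′ :* (x :* w) := x :* y′ :* w′ :* w) refl
                                  x (y ⁻¹) w (w ⁻¹) ⟩
      x / y / w * w          ≈⟨ /-*-cancel (pos⇒≉0 0<w) ⟩
      x / y                  ∎)
    (<-respʳ-≈ (begin
      y ⁻¹ * w ⁻¹ * (z * y)  ≈⟨ solve 4 (λ z y y′ w′ →
                                  y′ :* w′ :* (z :* y) := z :* w′ :* y′ :* y) refl
                                  z y (y ⁻¹) (w ⁻¹) ⟩
      z / w / y * y          ≈⟨ /-*-cancel (pos⇒≉0 0<y) ⟩
      z / w                  ∎)
    (*-monoˡ-<-pos (*-pos (⁻¹-pos 0<y) (⁻¹-pos 0<w)) xw<zy))

  1-*-split : ∀ x y → 1# - x * y ≈ (1# - y) + (1# - x) * y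
  1-*-split = solve 2 (λ x y → :1 :- x :* y := (:1 :- y) :+ (:1 :- x) :* y) refl

  -- By `1-*-split` this is a positive term plus a nonnegative one. The case x = 1 is included
  -- because deviations to pure strategies have to be covered.
  1-*-pos : ∀ {x y} → x ≤ 1# → 0# < y → y < 1# → 0# < 1# - x * y
  1-*-pos {x} {y} x≤1 0<y y<1 =
    <-respʳ-≈ (sym (1-*-split x y))
      (+-pos-nonneg (x<y⇒0<y-x y<1) (*-nonneg-pos (0≤1-x x≤1) 0<y))
    where
    0≤1-x : x ≤ 1# → 0# ≤ 1# - x
    0≤1-x (inj₁ x<1) = inj₁ (x<y⇒0<y-x x<1)
    0≤1-x (inj₂ x≈1) = inj₂ (sym (x≈y⇒x-y≈0 (sym x≈1)))

-- Cyclic symmetry of the players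

next : Player → Player
next 𝟏 = 𝟐
next 𝟐 = 𝟑
next 𝟑 = 𝟏

-- The condition of player i yields a formula for the probability of player `next i`; this shifts
-- such families back to index i.
∀-next : ∀ {ℓ} {P : Player → Set ℓ} → (∀ i → P (next i)) → ∀ i → P i
∀-next f 𝟏 = f 𝟑
∀-next f 𝟐 = f 𝟏
∀-next f 𝟑 = f 𝟐

-- For a variable player the two sides do not reduce to each other, so the closing of the cycle has
-- to be invoked explicitly.
next³ : ∀ i → next (next (next i)) ≡ i
next³ 𝟏 = ≡.refl
next³ 𝟐 = ≡.refl
next³ 𝟑 = ≡.refl

module Equilibria {r ℓ₁ ℓ₂} (ℝ : RealField r ℓ₁ ℓ₂) where
  open RealField ℝ
  open Game ℝ
  open OrderedFieldProperties orderedField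
  open Relation.Binary.Reasoning.Setoid setoid

  sum-rotate : (v : Vector Carrier 3) → ∀ i →
               v i + v (next i) + v (next (next i)) ≈ v 𝟏 + v 𝟐 + v 𝟑
  sum-rotate v 𝟏 = refl
  sum-rotate v 𝟐 = solve 3 (λ x y z → y :+ z :+ x := x :+ y :+ z) refl (v 𝟏) (v 𝟐) (v 𝟑)
  sum-rotate v 𝟑 = solve 3 (λ x y z → z :+ x :+ y := x :+ y :+ z) refl (v 𝟏) (v 𝟐) (v 𝟑)

  product-rotate : (v : Vector Carrier 3) → ∀ i →
                   v i * v (next i) * v (next (next i)) ≈ v 𝟏 * v 𝟐 * v 𝟑
  product-rotate v 𝟏 = refl
  product-rotate v 𝟐 = solve 3 (λ x y z → y :* z :* x := x :* y :* z) refl (v 𝟏) (v 𝟐) (v 𝟑)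
  product-rotate v 𝟑 = solve 3 (λ x y z → z :* x :* y := x :* y :* z) refl (v 𝟏) (v 𝟐) (v 𝟑)

  -- Decomposition of the expected payoff

  terminatingPayoff : Vector Carrier 3 → Payoff → Profile → Player → Carrier
  terminatingPayoff q u p i =
    q 𝟏 * expectation (terminatingDistribution p 𝟏) (u i) +
    q 𝟐 * expectation (terminatingDistribution p 𝟐) (u i) +
    q 𝟑 * expectation (terminatingDistribution p 𝟑) (u i)

  -- If all three probabilities were 1, then `Δ p` would vanish; hence the test inside
  -- `outcomeDistribution` takes its negative branch.
  expectedPayoff-terminating : ∀ q u p i → ¬ Δ p ≈ 0# →
                               expectedPayoff q u p i ≡ terminatingPayoff q u p i
  expectedPayoff-terminating q u p i Δ≉0
    rewrite dec-false (all? (λ j → p j ≟ 1#)) (λ p≈1 → Δ≉0 (begin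
      1# - p 𝟏 * p 𝟐 * p 𝟑  ≈⟨ +-congˡ (-‿cong (*-cong (*-cong (p≈1 𝟏) (p≈1 𝟐)) (p≈1 𝟑))) ⟩
      1# - 1# * 1# * 1#      ≈⟨ solve 0 (:1 :- :1 :* :1 :* :1 := :0) refl ⟩
      0#                     ∎))
    = ≡.refl

  -- The probability of returning to vᵢ once the cycle is followed from vᵢ.
  stay : Profile → Player → Carrier
  stay p i = p (next i) * p (next (next i))

  -- The expected number of times player i follows the cycle from vᵢ, given that
  -- vᵢ is reached: the sum of the geometric series x (x b)ⁿ with b = stay p i.
  passes : Profile → Player → Carrier → Carrier
  passes p i x = x / (1# - x * stay p i)

  -- The probability that play ever reaches vᵢ.
  reach : Vector Carrier 3 → Profile → Player → Carrier
  reach q p i = q i + q (next i) * stay p i + q (next (next i)) * p (next (next i))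

  -- The gain of player i from following the cycle once and leaving at the next
  -- visit to vᵢ, over leaving now.
  advantage : Payoff → Profile → Player → Carrier
  advantage u p i =
    (1# - p (next i)) * (u i (a (next i)) - u i (a i)) -
    p (next i) * (1# - p (next (next i))) * (u i (a i) - u i (a (next (next i))))

  -- The payoff of player i when he always leaves the cycle at vᵢ.
  baseline : Vector Carrier 3 → Payoff → Profile → Player → Carrier
  baseline q u p i =
    q i * u i (a i) +
    q (next i) * ((1# - p (next i)) * u i (a (next i)) +
                  p (next i) * (1# - p (next (next i))) * u i (a (next (next i))) +
                  stay p i * u i (a i)) +
    q (next (next i)) * ((1# - p (next (next i))) * u i (a (next (next i))) +
                         p (next (next i)) * u i (a i))

  private
    -- Solver syntax for `terminatingPayoff`, with `w` in place of `Δ p ⁻¹`. The term for infinite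
    -- play is kept with coefficient 0 so that the evaluated syntax matches the payoff literally.
    :payoff : ∀ {n} → Vector (Polynomial n) 3 → Vector (Polynomial n) 3 → Polynomial n →
              Vector (Polynomial n) 3 → Polynomial n → Polynomial n
    :payoff q p w f fc =
      q 𝟏 :* ((:1 :- p 𝟏) :* w :* f 𝟏 :+ p 𝟏 :* (:1 :- p 𝟐) :* w :* f 𝟐 :+
              p 𝟏 :* p 𝟐 :* (:1 :- p 𝟑) :* w :* f 𝟑 :+ :0 :* fc) :+
      q 𝟐 :* (p 𝟐 :* p 𝟑 :* (:1 :- p 𝟏) :* w :* f 𝟏 :+ (:1 :- p 𝟐) :* w :* f 𝟐 :+
              p 𝟐 :* (:1 :- p 𝟑) :* w :* f 𝟑 :+ :0 :* fc) :+
      q 𝟑 :* (p 𝟑 :* (:1 :- p 𝟏) :* w :* f 𝟏 :+ p 𝟏 :* p 𝟑 :* (:1 :- p 𝟐) :* w :* f 𝟐 :+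
              (:1 :- p 𝟑) :* w :* f 𝟑 :+ :0 :* fc)

    :decomposed : ∀ {n} → Player → Vector (Polynomial n) 3 → Vector (Polynomial n) 3 →
                  Polynomial n → Vector (Polynomial n) 3 → Polynomial n
    :decomposed i q p w f =
      (q i :* f i :+
       q j :* ((:1 :- p j) :* f j :+ p j :* (:1 :- p k) :* f k :+ p j :* p k :* f i) :+
       q k :* ((:1 :- p k) :* f k :+ p k :* f i)) :* ((:1 :- p 𝟏 :* p 𝟐 :* p 𝟑) :* w) :+
      (q i :+ q j :* (p j :* p k) :+ q k :* p k) :*
      ((:1 :- p j) :* (f j :- f i) :- p j :* (:1 :- p k) :* (f i :- f k)) :* (p i :* w)
      where
      j k : Player
      j = next i
      k = next (next i)

    :decomposition : Player → (q₁ q₂ q₃ p₁ p₂ p₃ w f₁ f₂ f₃ fc : Polynomial 11) →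
                     Polynomial 11 × Polynomial 11
    :decomposition i q₁ q₂ q₃ p₁ p₂ p₃ w f₁ f₂ f₃ fc =
      :payoff q p w f fc := :decomposed i q p w f
      where
      q p f : Vector (Polynomial 11) 3
      q = q₁ ∷ q₂ ∷ q₃ ∷ []
      p = p₁ ∷ p₂ ∷ p₃ ∷ []
      f = f₁ ∷ f₂ ∷ f₃ ∷ []

  -- With `Δ p ⁻¹` as an independent indeterminate this is a polynomial identity; the factor
  -- `Δ p * Δ p ⁻¹` is therefore left uncancelled. The split on the player lets `next` compute
  -- inside the solver syntax.
  terminatingPayoff-decomposition : ∀ q u p i →
    terminatingPayoff q u p i ≈
    baseline q u p i * (Δ p * Δ p ⁻¹) + reach q p i * advantage u p i * (p i / Δ p)
  terminatingPayoff-decomposition q u p 𝟏 = solve 11 (:decomposition 𝟏) refl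
    (q 𝟏) (q 𝟐) (q 𝟑) (p 𝟏) (p 𝟐) (p 𝟑) (Δ p ⁻¹) (u 𝟏 (a 𝟏)) (u 𝟏 (a 𝟐)) (u 𝟏 (a 𝟑)) (u 𝟏 c)
  terminatingPayoff-decomposition q u p 𝟐 = solve 11 (:decomposition 𝟐) refl
    (q 𝟏) (q 𝟐) (q 𝟑) (p 𝟏) (p 𝟐) (p 𝟑) (Δ p ⁻¹) (u 𝟐 (a 𝟏)) (u 𝟐 (a 𝟐)) (u 𝟐 (a 𝟑)) (u 𝟐 c)
  terminatingPayoff-decomposition q u p 𝟑 = solve 11 (:decomposition 𝟑) refl
    (q 𝟏) (q 𝟐) (q 𝟑) (p 𝟏) (p 𝟐) (p 𝟑) (Δ p ⁻¹) (u 𝟑 (a 𝟏)) (u 𝟑 (a 𝟐)) (u 𝟑 (a 𝟑)) (u 𝟑 c)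

  Δ-stay : ∀ p i → Δ p ≈ 1# - p i * stay p i
  Δ-stay p i = +-congˡ (-‿cong (trans (sym (product-rotate p i)) (*-assoc _ _ _)))

  -- Isolates the influence of `p i`: `baseline`, `reach` and `advantage` involve only the
  -- probabilities of the other two players, so `p i` enters through `passes` alone.
  expectedPayoff-decomposition : ∀ q u p i → 0# < 1# - p i * stay p i →
    expectedPayoff q u p i ≈
    baseline q u p i + reach q p i * advantage u p i * passes p i (p i)
  expectedPayoff-decomposition q u p i 0<1-xb = begin
    expectedPayoff q u p i     ≡⟨ expectedPayoff-terminating q u p i Δ≉0 ⟩
    terminatingPayoff q u p i  ≈⟨ terminatingPayoff-decomposition q u p i ⟩
    baseline q u p i * (Δ p * Δ p ⁻¹) + reach q p i * advantage u p i * (p i / Δ p)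
      ≈⟨ +-cong (trans (*-congˡ (*-inverse (Δ p) Δ≉0)) (*-identityʳ _))
                (*-congˡ (*-congˡ (⁻¹-cong (Δ-stay p i)))) ⟩
    baseline q u p i + reach q p i * advantage u p i * passes p i (p i)  ∎
    where
    Δ≉0 : ¬ Δ p ≈ 0#
    Δ≉0 Δ≈0 = pos⇒≉0 0<1-xb (trans (sym (Δ-stay p i)) Δ≈0)

  -- Best responses against strictly mixed opponents

  module _ {p : Profile} (mixed : StrictlyMixed p) where

    0<p : ∀ i → 0# < p i
    0<p i = proj₁ (mixed i)

    0<1-p : ∀ i → 0# < 1# - p i
    0<1-p i = x<y⇒0<y-x (proj₂ (mixed i))

    0<stay : ∀ i → 0# < stay p i
    0<stay i = *-pos (0<p (next i)) (0<p (next (next i)))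

    stay<1 : ∀ i → stay p i < 1#
    stay<1 i = 0<y-x⇒x<y
      (1-*-pos (inj₁ (proj₂ (mixed (next i)))) (0<p (next (next i))) (proj₂ (mixed (next (next i)))))

    0<1-x*stay : ∀ i {x} → x ≤ 1# → 0# < 1# - x * stay p i
    0<1-x*stay i x≤1 = 1-*-pos x≤1 (0<stay i) (stay<1 i)

    -- After cross-multiplication the terms with x y b cancel, where b is `stay p i`, and the
    -- difference is just `y - x`.
    passes-mono-< : ∀ i {x y} → x ≤ 1# → y ≤ 1# → x < y → passes p i x < passes p i y
    passes-mono-< i {x} {y} x≤1 y≤1 x<y =
      /-mono-< (0<1-x*stay i x≤1) (0<1-x*stay i y≤1) (0<y-x⇒x<y (<-respʳ-≈
        (solve 3 (λ x y b → y :- x := y :* (:1 :- x :* b) :- x :* (:1 :- y :* b)) refl x y (stay p i))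
        (x<y⇒0<y-x x<y)))

    -- Because the qⱼ sum to 1, reach p i exceeds stay p i > 0 by a nonnegative amount.
    0<reach : ∀ q → InitialDistribution q → ∀ i → 0# < reach q p i
    0<reach q (0≤q , Σq≈1) i = <-respʳ-≈ (begin
      y * z * 1# + (qᵢ * (1# - y * z) + qₖ * ((1# - y) * z))
        ≈⟨ +-congʳ (*-congˡ (trans (sym Σq≈1) (sym (sum-rotate q i)))) ⟩
      y * z * (qᵢ + qⱼ + qₖ) + (qᵢ * (1# - y * z) + qₖ * ((1# - y) * z))
        ≈⟨ solve 5 (λ qᵢ qⱼ qₖ y z →
             y :* z :* (qᵢ :+ qⱼ :+ qₖ) :+ (qᵢ :* (:1 :- y :* z) :+ qₖ :* ((:1 :- y) :* z)) :=
             qᵢ :+ qⱼ :* (y :* z) :+ qₖ :* z) refl qᵢ qⱼ qₖ y z ⟩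
      qᵢ + qⱼ * (y * z) + qₖ * z  ∎)
      (+-pos-nonneg (<-respʳ-≈ (sym (*-identityʳ _)) (0<stay i))
        (+-nonneg (*-nonneg-pos (0≤q i) (x<y⇒0<y-x (stay<1 i)))
                  (*-nonneg-pos (0≤q (next (next i)))
                    (*-pos (0<1-p (next i)) (0<p (next (next i)))))))
      where
      y z qᵢ qⱼ qₖ : Carrier
      y = p (next i)
      z = p (next (next i))
      qᵢ = q i
      qⱼ = q (next i)
      qₖ = q (next (next i))

    expectedPayoff-own : ∀ q u i →
      expectedPayoff q u p i ≈
      baseline q u p i + reach q p i * advantage u p i * passes p i (p i)
    expectedPayoff-own q u i =
      expectedPayoff-decomposition q u p i (0<1-x*stay i (inj₁ (proj₂ (mixed i))))

    -- For a concrete player `updateAt` computes, so the quantities built from the other two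
    -- players' probabilities are literally those of `p`.
    expectedPayoff-deviate : ∀ q u i {x} → x ≤ 1# →
      expectedPayoff q u (deviate p i x) i ≈
      baseline q u p i + reach q p i * advantage u p i * passes p i x
    expectedPayoff-deviate q u 𝟏 {x} x≤1 =
      expectedPayoff-decomposition q u (deviate p 𝟏 x) 𝟏 (0<1-x*stay 𝟏 x≤1)
    expectedPayoff-deviate q u 𝟐 {x} x≤1 =
      expectedPayoff-decomposition q u (deviate p 𝟐 x) 𝟐 (0<1-x*stay 𝟐 x≤1)
    expectedPayoff-deviate q u 𝟑 {x} x≤1 =
      expectedPayoff-decomposition q u (deviate p 𝟑 x) 𝟑 (0<1-x*stay 𝟑 x≤1)

    improves : ∀ q u i {x} → x ≤ 1# →
      reach q p i * advantage u p i * passes p i (p i) < reach q p i * advantage u p i * passes p i x →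
      expectedPayoff q u (deviate p i x) i > expectedPayoff q u p i
    improves q u i x≤1 lt =
      <-respˡ-≈ (sym (expectedPayoff-own q u i))
        (<-respʳ-≈ (sym (expectedPayoff-deviate q u i x≤1)) (+-monoʳ-< _ lt))

    -- Since `reach` is positive and `passes` strictly increasing, a positive advantage makes the
    -- deviation to 1 profitable and a negative one the deviation to 0. Both are strict improvements
    -- because `p i` is interior.
    equilibrium⇒advantage≈0 : ∀ q → InitialDistribution q → ∀ u →
      NashEquilibrium q u p → ∀ i → advantage u p i ≈ 0#
    equilibrium⇒advantage≈0 q dist u (_ , optimal) i with compare (advantage u p i) 0#
    ... | tri≈ _ D≈0 _ = D≈0
    ... | tri> _ _ 0<D = contradiction
      (improves q u i (inj₂ refl)
        (*-monoˡ-<-pos (*-pos (0<reach q dist i) 0<D)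
          (passes-mono-< i (inj₁ p<1) (inj₂ refl) p<1)))
      (optimal i 1# (inj₁ 0<1 , inj₂ refl))
      where
      p<1 : p i < 1#
      p<1 = proj₂ (mixed i)
    ... | tri< D<0 _ _ = contradiction
      (improves q u i (inj₁ 0<1)
        (*-monoˡ-<-neg
          (<-respʳ-≈ (zeroʳ _) (*-monoˡ-<-pos (0<reach q dist i) D<0))
          (passes-mono-< i (inj₁ 0<1) (inj₁ (proj₂ (mixed i))) (0<p i))))
      (optimal i 0# (inj₂ refl , inj₁ 0<1))

    -- With zero advantage only `baseline` remains, so the payoff of each player is constant in his
    -- own probability.
    advantage≈0⇒equilibrium : ∀ q u → (∀ i → advantage u p i ≈ 0#) → NashEquilibrium q u p
    advantage≈0⇒equilibrium q u D≈0 =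
      (λ i → inj₁ (0<p i) , inj₁ (proj₂ (mixed i))) ,
      (λ i x (_ , x≤1) → <-irrefl (begin
        expectedPayoff q u p i                ≈⟨ expectedPayoff-own q u i ⟩
        baseline q u p i + reach q p i * advantage u p i * passes p i (p i)
                                              ≈⟨ +-congˡ (vanish i _) ⟩
        baseline q u p i + 0#                 ≈⟨ +-congˡ (vanish i _) ⟨
        baseline q u p i + reach q p i * advantage u p i * passes p i x
                                              ≈⟨ expectedPayoff-deviate q u i x≤1 ⟨
        expectedPayoff q u (deviate p i x) i  ∎))
      where
      vanish : ∀ i x → reach q p i * advantage u p i * x ≈ 0#
      vanish i x = trans (*-congʳ (trans (*-congˡ (D≈0 i)) (zeroʳ _))) (zeroˡ x)

  -- Indifference as balance equations

  CyclicPreference : Payoff → Player → Set _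
  CyclicPreference u i =
    u i (a (next i)) > u i (a i) × u i (a i) > u i (a (next (next i)))

  μ : Payoff → Vector Carrier 3
  μ u i = (u i (a (next i)) - u i (a i)) / (u i (a i) - u i (a (next (next i))))

  Balanced : Vector Carrier 3 → Profile → Set _
  Balanced m p = ∀ i → m i * (1# - p (next i)) ≈ p (next i) * (1# - p (next (next i)))

  module _ (u : Payoff) (cyclic : ∀ i → CyclicPreference u i) where

    0<μ : ∀ i → 0# < μ u i
    0<μ i = /-pos (x<y⇒0<y-x (proj₁ (cyclic i))) (x<y⇒0<y-x (proj₂ (cyclic i)))

    loss≉0 : ∀ i → ¬ (u i (a i) - u i (a (next (next i)))) ≈ 0#
    loss≉0 i = pos⇒≉0 (x<y⇒0<y-x (proj₂ (cyclic i)))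

    -- Dividing by the positive loss `u i (a i) - u i (a (next (next i)))` turns the indifference
    -- condition into one in which payoffs occur only through `μ`.
    advantage-μ : ∀ p i →
      advantage u p i ≈
      (μ u i * (1# - p (next i)) - p (next i) * (1# - p (next (next i)))) *
      (u i (a i) - u i (a (next (next i))))
    advantage-μ p i = begin
      (1# - p (next i)) * (u i (a (next i)) - u i (a i)) -
      p (next i) * (1# - p (next (next i))) * (u i (a i) - u i (a (next (next i))))
        ≈⟨ +-congʳ (*-congˡ (sym (/-*-cancel (loss≉0 i)))) ⟩
      (1# - p (next i)) * (μ u i * (u i (a i) - u i (a (next (next i))))) -
      p (next i) * (1# - p (next (next i))) * (u i (a i) - u i (a (next (next i))))
        ≈⟨ solve 4 (λ y z m β →
             (:1 :- y) :* (m :* β) :- y :* (:1 :- z) :* β :=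
             (m :* (:1 :- y) :- y :* (:1 :- z)) :* β) refl
             (p (next i)) (p (next (next i))) (μ u i) (u i (a i) - u i (a (next (next i)))) ⟩
      (μ u i * (1# - p (next i)) - p (next i) * (1# - p (next (next i)))) *
      (u i (a i) - u i (a (next (next i))))  ∎

    advantage≈0⇒balanced : ∀ p → (∀ i → advantage u p i ≈ 0#) → Balanced (μ u) p
    advantage≈0⇒balanced p D≈0 i = x-y≈0⇒x≈y (*-cancelʳ (loss≉0 i)
      (trans (sym (advantage-μ p i)) (trans (D≈0 i) (sym (zeroˡ _)))))

    balanced⇒advantage≈0 : ∀ p → Balanced (μ u) p → ∀ i → advantage u p i ≈ 0#
    balanced⇒advantage≈0 p bal i =
      trans (advantage-μ p i) (trans (*-congʳ (x≈y⇒x-y≈0 (bal i))) (zeroˡ _))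

  -- Solving the balance equations

  δ : Vector Carrier 3 → Player → Carrier
  δ m i = 1# + m i + m i * m (next i)

  Solution : Vector Carrier 3 → Profile → Set _
  Solution m p = ∀ i → p (next i) ≈ m i * δ m (next i) / δ m i

  -- The three equations are multiplied. Both sides then contain the product of all `1# - p i`,
  -- which is nonzero for a strictly mixed profile and cancels.
  balanced⇒product : ∀ m p → StrictlyMixed p → Balanced m p →
                     m 𝟏 * m 𝟐 * m 𝟑 ≈ p 𝟏 * p 𝟐 * p 𝟑
  balanced⇒product m p mixed bal =
    *-cancelʳ (pos⇒≉0 (*-pos (*-pos (0<1-p mixed 𝟏) (0<1-p mixed 𝟐)) (0<1-p mixed 𝟑))) (begin
      m 𝟏 * m 𝟐 * m 𝟑 * ((1# - x) * (1# - y) * (1# - z))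
        ≈⟨ solve 6 (λ m n o x y z →
             m :* n :* o :* ((:1 :- x) :* (:1 :- y) :* (:1 :- z)) :=
             m :* (:1 :- y) :* (n :* (:1 :- z)) :* (o :* (:1 :- x))) refl
             (m 𝟏) (m 𝟐) (m 𝟑) x y z ⟩
      m 𝟏 * (1# - y) * (m 𝟐 * (1# - z)) * (m 𝟑 * (1# - x))
        ≈⟨ *-cong (*-cong (bal 𝟏) (bal 𝟐)) (bal 𝟑) ⟩
      y * (1# - z) * (z * (1# - x)) * (x * (1# - y))
        ≈⟨ solve 3 (λ x y z →
             y :* (:1 :- z) :* (z :* (:1 :- x)) :* (x :* (:1 :- y)) :=
             x :* y :* z :* ((:1 :- x) :* (:1 :- y) :* (:1 :- z))) refl x y z ⟩
      x * y * z * ((1# - x) * (1# - y) * (1# - z))  ∎)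
    where
    x y z : Carrier
    x = p 𝟏
    y = p 𝟐
    z = p 𝟑

  module _ (m : Vector Carrier 3) (0<m : ∀ i → 0# < m i) where

    0<δ : ∀ i → 0# < δ m i
    0<δ i = +-pos (+-pos 0<1 (0<m i)) (*-pos (0<m i) (0<m (next i)))

    balanced⇒solution : ∀ p → StrictlyMixed p → Balanced m p → Solution m p
    balanced⇒solution p mixed bal i = /-unique (pos⇒≉0 (0<δ i)) (begin
      y * (1# + mᵢ + mᵢ * mⱼ)
        -- The left side is written as `m * (1# + n) + x * y * z` plus multiples of the defects of
        -- the balance equations of i and `next i`. The defects vanish, and `balanced⇒product`
        -- replaces the only remaining nonlinear term in the probabilities.
        ≈⟨ solve 5 (λ x y z m n →
             y :* (:1 :+ m :+ m :* n) :=
             m :* (:1 :+ n) :+ x :* y :* z :+ (:1 :+ n) :* (y :* (:1 :- z) :- m :* (:1 :- y)) :+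
             y :* (z :* (:1 :- x) :- n :* (:1 :- z))) refl x y z mᵢ mⱼ ⟩
      mᵢ * (1# + mⱼ) + x * y * z + (1# + mⱼ) * (y * (1# - z) - mᵢ * (1# - y)) +
      y * (z * (1# - x) - mⱼ * (1# - z))
        ≈⟨ +-cong (+-cong (+-congˡ xyz≈mmm) (*-congˡ (x≈y⇒x-y≈0 (sym (bal i)))))
                  (*-congˡ (x≈y⇒x-y≈0 (sym zx))) ⟩
      mᵢ * (1# + mⱼ) + mᵢ * mⱼ * mₖ + (1# + mⱼ) * 0# + y * 0#
        ≈⟨ solve 4 (λ y m n o →
             m :* (:1 :+ n) :+ m :* n :* o :+ (:1 :+ n) :* :0 :+ y :* :0 :=
             m :* (:1 :+ n :+ n :* o)) refl y mᵢ mⱼ mₖ ⟩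
      mᵢ * (1# + mⱼ + mⱼ * mₖ)  ∎)
      where
      x y z mᵢ mⱼ mₖ : Carrier
      x = p i
      y = p (next i)
      z = p (next (next i))
      mᵢ = m i
      mⱼ = m (next i)
      mₖ = m (next (next i))
      xyz≈mmm : x * y * z ≈ mᵢ * mⱼ * mₖ
      xyz≈mmm = trans (product-rotate p i)
        (trans (sym (balanced⇒product m p mixed bal)) (sym (product-rotate m i)))
      zx : mⱼ * (1# - z) ≈ z * (1# - x)
      zx = ≡.subst (λ l → mⱼ * (1# - z) ≈ z * (1# - p l)) (next³ i) (bal (next i))

    -- The numerator telescopes: in `δ m i - m i * δ m (next i)` everything cancels except 1 and the
    -- triple product.
    solution-complement : ∀ p → Solution m p → ∀ i →
                          1# - p (next i) ≈ (1# - m 𝟏 * m 𝟐 * m 𝟑) / δ m i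
    solution-complement p sol i = /-unique (pos⇒≉0 (0<δ i)) (begin
      (1# - p (next i)) * δ m i
        ≈⟨ solve 2 (λ y d → (:1 :- y) :* d := d :- y :* d) refl (p (next i)) (δ m i) ⟩
      δ m i - p (next i) * δ m i
        ≈⟨ +-congˡ (-‿cong (trans (*-congʳ (sol i)) (/-*-cancel (pos⇒≉0 (0<δ i))))) ⟩
      δ m i - m i * δ m (next i)
        ≈⟨ solve 3 (λ m n o →
             (:1 :+ m :+ m :* n) :- m :* (:1 :+ n :+ n :* o) := :1 :- m :* n :* o) refl
             (m i) (m (next i)) (m (next (next i))) ⟩
      1# - m i * m (next i) * m (next (next i))
        ≈⟨ +-congˡ (-‿cong (product-rotate m i)) ⟩
      1# - m 𝟏 * m 𝟐 * m 𝟑  ∎)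

    solution⇒balanced : ∀ p → Solution m p → Balanced m p
    solution⇒balanced p sol i = begin
      m i * (1# - p (next i))
        ≈⟨ *-congˡ (solution-complement p sol i) ⟩
      m i * (s / δ m i)
        ≈⟨ *-identityʳ _ ⟨
      m i * (s / δ m i) * 1#
        -- The inserted quotient supplies the numerator of `p (next i)` and the denominator of the
        -- complement of `p (next (next i))`.
        ≈⟨ *-congˡ (*-inverse (δ m (next i)) (pos⇒≉0 (0<δ (next i)))) ⟨
      m i * (s / δ m i) * (δ m (next i) / δ m (next i))
        ≈⟨ solve 5 (λ m s w d v → m :* (s :* w) :* (d :* v) := m :* d :* w :* (s :* v)) refl
             (m i) s (δ m i ⁻¹) (δ m (next i)) (δ m (next i) ⁻¹) ⟩
      m i * δ m (next i) / δ m i * (s / δ m (next i))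
        ≈⟨ *-cong (sol i) (solution-complement p sol (next i)) ⟨
      p (next i) * (1# - p (next (next i)))  ∎
      where
      s : Carrier
      s = 1# - m 𝟏 * m 𝟐 * m 𝟑

    -- Positivity is visible in the formula; the bound on the triple product makes the complement
    -- from `solution-complement` positive.
    solution⇒mixed : ∀ p → m 𝟏 * m 𝟐 * m 𝟑 < 1# → Solution m p → StrictlyMixed p
    solution⇒mixed p s<1 sol = ∀-next λ i →
      <-respʳ-≈ (sym (sol i)) (/-pos (*-pos (0<m i) (0<δ (next i))) (0<δ i)) ,
      0<y-x⇒x<y (<-respʳ-≈ (sym (solution-complement p sol i)) (/-pos (x<y⇒0<y-x s<1) (0<δ i)))

-- Existence, uniqueness and non-existence of the equilibrium

proposition6 : ∀ {r ℓ₁ ℓ₂} (ℝ : RealField r ℓ₁ ℓ₂) →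
    let open RealField ℝ
        open Game ℝ
    in
    (q : Vector Carrier 3) → InitialDistribution q →
    (u : Payoff) →
    u 𝟏 (a 𝟐) > u 𝟏 (a 𝟏) × u 𝟏 (a 𝟏) > u 𝟏 (a 𝟑) × u 𝟏 (a 𝟑) > u 𝟏 c →
    u 𝟐 (a 𝟑) > u 𝟐 (a 𝟐) × u 𝟐 (a 𝟐) > u 𝟐 (a 𝟏) × u 𝟐 (a 𝟏) > u 𝟐 c →
    u 𝟑 (a 𝟏) > u 𝟑 (a 𝟑) × u 𝟑 (a 𝟑) > u 𝟑 (a 𝟐) × u 𝟑 (a 𝟐) > u 𝟑 c →
    let μ₁ = (u 𝟏 (a 𝟐) - u 𝟏 (a 𝟏)) / (u 𝟏 (a 𝟏) - u 𝟏 (a 𝟑))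
        μ₂ = (u 𝟐 (a 𝟑) - u 𝟐 (a 𝟐)) / (u 𝟐 (a 𝟐) - u 𝟐 (a 𝟏))
        μ₃ = (u 𝟑 (a 𝟏) - u 𝟑 (a 𝟑)) / (u 𝟑 (a 𝟑) - u 𝟑 (a 𝟐))
        p₁ = (μ₃ * (1# + μ₁ + μ₁ * μ₂)) / (1# + μ₃ + μ₃ * μ₁)
        p₂ = (μ₁ * (1# + μ₂ + μ₂ * μ₃)) / (1# + μ₁ + μ₁ * μ₂)
        p₃ = (μ₂ * (1# + μ₃ + μ₃ * μ₁)) / (1# + μ₂ + μ₂ * μ₃)
        p* = p₁ ∷ p₂ ∷ p₃ ∷ []
    in
    (μ₁ * μ₂ * μ₃ < 1# →
      StrictlyMixedEquilibrium q u p* ×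
      (∀ p → StrictlyMixedEquilibrium q u p → ∀ i → p i ≈ p* i)) ×
    (μ₁ * μ₂ * μ₃ ≥ 1# →
      ¬ (∃ λ p → StrictlyMixedEquilibrium q u p))
proposition6 ℝ q dist u (u₁ , u₁′ , _) (u₂ , u₂′ , _) (u₃ , u₃′ , _) =
  (λ s<1 →
    let mixed = solution⇒mixed (μ u) 0<m p* s<1 p*-solution in
    ( advantage≈0⇒equilibrium mixed q u
        (balanced⇒advantage≈0 u cyclic p* (solution⇒balanced (μ u) 0<m p* p*-solution))
    , mixed ) ,
    λ p (nash , mixed-p) →
      ∀-next λ i → trans (balanced⇒solution (μ u) 0<m p mixed-p (balanced p nash mixed-p) i)
                         (sym (p*-solution i))) ,
  λ 1≤s (p , nash , mixed-p) →
    s≱1 p (balanced⇒product (μ u) p mixed-p (balanced p nash mixed-p)) mixed-p 1≤s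
  where
  open RealField ℝ
  open Game ℝ
  open Equilibria ℝ
  open OrderedFieldProperties orderedField

  cyclic : ∀ i → CyclicPreference u i
  cyclic 𝟏 = u₁ , u₁′
  cyclic 𝟐 = u₂ , u₂′
  cyclic 𝟑 = u₃ , u₃′

  0<m : ∀ i → 0# < μ u i
  0<m = 0<μ u cyclic

  -- The candidate in terms of `μ` and `δ`, which unfolds to the stated fractions. The first entry
  -- carries index 𝟑 because `next 𝟑` is 𝟏.
  p* : Profile
  p* = μ u 𝟑 * δ (μ u) 𝟏 / δ (μ u) 𝟑 ∷
       μ u 𝟏 * δ (μ u) 𝟐 / δ (μ u) 𝟏 ∷
       μ u 𝟐 * δ (μ u) 𝟑 / δ (μ u) 𝟐 ∷ []

  p*-solution : Solution (μ u) p*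
  p*-solution 𝟏 = refl
  p*-solution 𝟐 = refl
  p*-solution 𝟑 = refl

  balanced : ∀ p → NashEquilibrium q u p → StrictlyMixed p → Balanced (μ u) p
  balanced p nash mixed =
    advantage≈0⇒balanced u cyclic p (equilibrium⇒advantage≈0 mixed q dist u nash)

  -- The product of the three probabilities is below 1, since `Δ p` is positive for a strictly mixed
  -- profile.
  s≱1 : ∀ p {s} → s ≈ p 𝟏 * p 𝟐 * p 𝟑 → StrictlyMixed p → ¬ 1# ≤ s
  s≱1 p s≈ppp mixed 1≤s with
    <-respˡ-≈ (sym s≈ppp) (0<y-x⇒x<y (<-respʳ-≈ (sym (Δ-stay p 𝟏))
      (0<1-x*stay mixed 𝟏 (inj₁ (proj₂ (mixed 𝟏))))))
  s≱1 _ _ _ (inj₁ 1<s) | s<1 = <-irrefl refl (<-trans 1<s s<1)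
  s≱1 _ _ _ (inj₂ 1≈s) | s<1 = <-irrefl (sym 1≈s) s<1
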